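{- There is a weight-preserving bijection between $\mathcal{O}_n$ and $\mathcal{T}_n$.
   Context: A complete monotone triangle of order $n$ is a triangular array of integers with $n$ rows and $k$ entries in the $k$-th row, each row strictly increasing, the final row being $1,2,\ldots,n$ in ascending order, and each entry not in the final row lying weakly between the entries immediately to its left and right in the row below. For an entry $j$ not in the bottom row with neighbours $i$ (below left) and $k$ (below right), exactly one of the following holds: (i) $i=j<k$, (ii) $i<j=k$, (iii) $i<j<k$. An oriented complete monotone triangle is a complete monotone triangle in which each entry not in the bottom row is given an orientation (left or right), where entries of type (i) must be oriented right, entries of type (ii) must be oriented left, and entries of type (iii) may be oriented either way. $\mathcal{O}_n$ denotes the set of oriented complete monotone triangles of order $n$. The weight of such a triangle is the product, over all entries not in the bottom row, of $x_j$ for each right-oriented entry $j$ and $y_j$ for each left-oriented entry $j$ (with $x_1,\ldots,x_n,y_1,\ldots,y_n$ indeterminates). $\mathcal{T}_n$ denotes the set of tournaments on $\{1,2,\ldots,n\}$, i.e. orientations of the complete graph on this vertex set. The weight of a tournament is the product of the weights of its edges, where an edge oriented from $i$ to $j$ has weight $x_i$ if $i<j$ and $y_i$ if $i>j$. -}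

module Defs where

open import Data.Nat using (ℕ; zero; suc; _≤_; _<_; _∸_)
open import Data.List using (List; []; _∷_; map; length; upTo; _++_; concatMap)
open import Data.Vec using (Vec; toList)
open import Data.Product using (Σ; _×_; _,_; proj₁)
open import Data.Unit using (⊤; tt)
open import Data.Empty using (⊥)
open import Relation.Binary.PropositionalEquality using (_≡_)

-- Monomials in the commuting indeterminates x₁..xₙ, y₁..yₙ are
-- represented as multisets of variables, i.e. lists of variables up to
-- permutation (_↭_).  'x j' stands for x_j and 'y j' for y_j.

data Var : Set where
  x : ℕ → Var
  y : ℕ → Var

data Orient : Set where
  L R : Orient

-- Allowed orientation of entry j with below-left i and below-right k
-- (given i ≤ j ≤ k, i < k):
--   type (i)   i = j < k : only R;
--   type (ii)  i < j = k : only L;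
--   type (iii) i < j < k : either.
-- Equivalently: R is allowed iff j < k, L is allowed iff i < j.
data OrientOK (i j k : ℕ) : Orient → Set where
  okR : j < k → OrientOK i j k R
  okL : i < j → OrientOK i j k L

Increasing : List ℕ → Set
Increasing [] = ⊤
Increasing (a ∷ []) = ⊤
Increasing (a ∷ b ∷ rest) = a < b × Increasing (b ∷ rest)

Compat : List (ℕ × Orient) → List ℕ → Set
Compat [] (b ∷ []) = ⊤
Compat ((a , o) ∷ as) (b ∷ b' ∷ bs) =
  b ≤ a × a ≤ b' × OrientOK b a b' o × Compat as (b' ∷ bs)
Compat _ _ = ⊥

entries : List (ℕ × Orient) → List ℕ
entries = map proj₁

nextRow : List (List (ℕ × Orient)) → List ℕ → List ℕ
nextRow [] bottom = bottom
nextRow (r ∷ _) _ = entries r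

Chain : List (List (ℕ × Orient)) → List ℕ → Set
Chain [] bottom = ⊤
Chain (r ∷ rs) bottom =
  Increasing (entries r) × Compat r (nextRow rs bottom) × Chain rs bottom

bottomRow : ℕ → List ℕ
bottomRow n = map suc (upTo n)

-- 𝒪ₙ : a triangle is determined by its n ∸ 1 non-bottom rows (listed from
-- top to bottom, each entry with its orientation); the bottom row is 1..n.
-- Row lengths 1, 2, …, n−1 are forced by Compat and the row count.
OCMT : ℕ → Set
OCMT n = Σ (List (List (ℕ × Orient)))
           (λ rows → (length rows ≡ n ∸ 1) × Chain rows (bottomRow n))

entryVar : ℕ × Orient → Var
entryVar (j , R) = x j
entryVar (j , L) = y j

oweight : {n : ℕ} → OCMT n → List Var
oweight (rows , _) = concatMap (map entryVar) rows

-- orientation of the edge between a vertex i and a larger vertex m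
data Dir : Set where
  up   : Dir   -- i → m  (weight x_i)
  down : Dir   -- m → i  (weight y_m)

-- Tournament (suc m): a tournament on {1..m} together with the
-- orientations of the m edges {i, m+1}, i = 1..m (the i-th vector entry
-- is the edge {i, m+1}).
Tournament : ℕ → Set
Tournament zero = ⊤
Tournament (suc m) = Tournament m × Vec Dir m

edgeWeights : ℕ → ℕ → List Dir → List Var
edgeWeights top i [] = []
edgeWeights top i (up ∷ ds) = x i ∷ edgeWeights top (suc i) ds
edgeWeights top i (down ∷ ds) = y top ∷ edgeWeights top (suc i) ds

tweight : (n : ℕ) → Tournament n → List Var
tweight zero _ = []
tweight (suc m) (t , v) = tweight m t ++ edgeWeights (suc m) 1 (toList v)

{-# OPTIONS --safe #-}
-- An oriented monotone triangle is a state of the six-vertex model: vertex (r , m)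
-- lies in column m between rows r − 1 and r of the triangle, the vertical edges of
-- column m carry the entries equal to m, and a horizontal edge tells whether to its
-- left the row below has one entry more than the row above.  Read by columns, the
-- generating polynomial of the triangles is a product of transfer matrices C₁ ⋯ Cₙ.
-- Orienting the entries factors Cₘ as Yₘ Xₘ, where Yₘ carries the entries m oriented
-- left and Xₘ those oriented right.  On states whose bottom bit is set,
-- yⱼ Xᵢ Yⱼ = (xᵢ + yⱼ) Yⱼ Xᵢ, so moving Yⱼ to the left of all Xᵢ with i < j produces
-- one factor xᵢ + yⱼ, the choice of an edge orientation, for each i < j.  Applied to
-- the state with j − 1 packed bits, Yⱼ then has the single outcome with j packed
-- bits, of weight yⱼ^(j − 1), which cancels the powers of yⱼ spent on the way.  No
-- step subtracts, so each identity of polynomials is a bijection of weighted sets.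
module Submission where

open import Defs
open import Algebra.Bundles using (CommutativeSemiring)
import Algebra.Solver.Ring.NaturalCoefficients.Default as SemiringSolver
open import Algebra.Structures.Biased using (IsCommutativeSemiringˡ)
open import Axiom.UniquenessOfIdentityProofs using (module Decidable⇒UIP)
open import Data.Bool using (Bool; true; false)
import Data.Bool.Properties as Bool
open import Data.Empty using (⊥; ⊥-elim)
open import Data.List as List
  using (List; []; _∷_; _++_; _∷ʳ_; length; replicate; concatMap; applyUpTo; upTo; initLast; _∷ʳ′_)
open import Data.List.Properties
  using (++-assoc; ++-identityʳ; ∷-injective; ∷ʳ-injective; concatMap-++; length-++; length-map;
         length-upTo; map-upTo)
open import Data.List.Relation.Binary.Permutation.Propositional
  using (_↭_; ↭-refl; ↭-sym; ↭-trans; ↭-reflexive)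
open import Data.List.Relation.Binary.Permutation.Propositional.Properties
  using (++⁺ˡ; ++-comm; drop-∷; shifts)
open import Data.List.Relation.Unary.All as All using (All; []; _∷_)
open import Data.Maybe using (Maybe; just; nothing; is-just)
open import Data.Nat using (ℕ; zero; suc; _+_; _∸_; _≤_; _<_; z≤n; s≤s; _≟_)
open import Data.Nat.Properties
  using (+-suc; +-comm; +-identityʳ; ≤-refl; ≤-trans; <-trans; ≤-<-trans; <-≤-trans; <⇒≤; <-irrefl;
         n≤1+n; n<1+n; m<m+n; ≤∧≢⇒<; ≤-irrelevant; ≡-irrelevant; suc-injective)
open import Data.Product using (Σ; _×_; _,_; proj₁; proj₂)
open import Data.Sum using (_⊎_; inj₁; inj₂)
open import Data.Unit using (⊤; tt)
open import Data.Vec as Vec using (Vec; []; _∷_; toList)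
open import Data.Vec.Properties using (≡-dec)
open import Function.Base using (_∘_)
open import Function.Bundles using (_↔_; Inverse; mk↔ₛ′)
import Relation.Binary.Reasoning.Setoid as SetoidReasoning
open import Relation.Binary.PropositionalEquality
  using (_≡_; refl; sym; trans; cong; cong₂; subst)
open import Relation.Binary.Structures using (IsEquivalence)
open import Relation.Nullary using (yes; no)

-- Weighted sets and their commutative semiring.

-- A weighted set stands for the generating polynomial of its weights, and an
-- isomorphism of weighted sets for an equality of polynomials.
record WSet : Set₁ where
  constructor wset
  field
    Carrier : Set
    weight  : Carrier → List Var

open WSet

infix 4 _≃_

record _≃_ (A B : WSet) : Set where
  constructor iso
  field
    to      : Carrier A → Carrier B
    from    : Carrier B → Carrier A
    to∘from : ∀ b → to (from b) ≡ b
    from∘to : ∀ a → from (to a) ≡ a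
    weight≃ : ∀ a → weight B (to a) ↭ weight A a

open _≃_

≃-refl : ∀ {A} → A ≃ A
≃-refl = iso (λ a → a) (λ a → a) (λ _ → refl) (λ _ → refl) (λ _ → ↭-refl)

≃-sym : ∀ {A B} → A ≃ B → B ≃ A
≃-sym {A} {B} e = iso (from e) (to e) (from∘to e) (to∘from e)
  (λ b → ↭-trans (↭-sym (weight≃ e (from e b))) (↭-reflexive (cong (weight B) (to∘from e b))))

≃-trans : ∀ {A B C} → A ≃ B → B ≃ C → A ≃ C
≃-trans e f = iso (to f ∘ to e) (from e ∘ from f)
  (λ c → trans (cong (to f) (to∘from e (from f c))) (to∘from f c))
  (λ a → trans (cong (from e) (from∘to f (to e a))) (from∘to e a))
  (λ a → ↭-trans (weight≃ f (to e a)) (weight≃ e a))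

infixr 7 _⊗_
infixr 6 _⊕_

𝟘 𝟙 : WSet
𝟘 = wset ⊥ (λ ())
𝟙 = wset ⊤ (λ _ → [])

guard : Set → WSet
guard P = wset P (λ _ → [])

mono : List Var → WSet
mono l = wset ⊤ (λ _ → l)

_⊕_ _⊗_ : WSet → WSet → WSet
A ⊕ B = wset (Carrier A ⊎ Carrier B) λ { (inj₁ a) → weight A a ; (inj₂ b) → weight B b }
A ⊗ B = wset (Carrier A × Carrier B) λ { (a , b) → weight A a ++ weight B b }

∑ : (I : Set) → (I → WSet) → WSet
∑ I F = wset (Σ I (Carrier ∘ F)) λ { (i , a) → weight (F i) a }

-- The isomorphism may depend on the element of `A`. A matrix entry `A` can thus supply facts about
-- the states it joins.
⊗-congʳ-on : ∀ A {B C} → (Carrier A → B ≃ C) → A ⊗ B ≃ A ⊗ C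
⊗-congʳ-on A e = iso (λ { (a , b) → a , to (e a) b }) (λ { (a , c) → a , from (e a) c })
  (λ { (a , c) → cong (a ,_) (to∘from (e a) c) })
  (λ { (a , b) → cong (a ,_) (from∘to (e a) b) })
  (λ { (a , b) → ++⁺ˡ (weight A a) (weight≃ (e a) b) })

⊗-comm : ∀ A B → A ⊗ B ≃ B ⊗ A
⊗-comm A B = iso (λ { (a , b) → b , a }) (λ { (b , a) → a , b }) (λ _ → refl) (λ _ → refl)
  (λ { (a , b) → ++-comm (weight B b) (weight A a) })

⊗-congʳ : ∀ A {B C} → B ≃ C → A ⊗ B ≃ A ⊗ C
⊗-congʳ A e = ⊗-congʳ-on A (λ _ → e)

⊗-congˡ : ∀ C {A B} → A ≃ B → A ⊗ C ≃ B ⊗ C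
⊗-congˡ C {A} {B} e = ≃-trans (⊗-comm A C) (≃-trans (⊗-congʳ C e) (⊗-comm C B))

⊗-cong : ∀ {A B C D} → A ≃ B → C ≃ D → A ⊗ C ≃ B ⊗ D
⊗-cong {B = B} {C} e f = ≃-trans (⊗-congˡ C e) (⊗-congʳ B f)

⊗-assoc : ∀ A B C → (A ⊗ B) ⊗ C ≃ A ⊗ (B ⊗ C)
⊗-assoc A B C = iso (λ { ((a , b) , c) → a , b , c }) (λ { (a , b , c) → (a , b) , c })
  (λ _ → refl) (λ _ → refl)
  (λ { ((a , b) , c) → ↭-reflexive (sym (++-assoc (weight A a) (weight B b) (weight C c))) })

⊗-identityˡ : ∀ A → 𝟙 ⊗ A ≃ A
⊗-identityˡ A = iso (λ { (_ , a) → a }) (λ a → tt , a) (λ _ → refl) (λ _ → refl) (λ _ → ↭-refl)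

⊕-cong : ∀ {A B C D} → A ≃ B → C ≃ D → A ⊕ C ≃ B ⊕ D
⊕-cong e f = iso
  (λ { (inj₁ a) → inj₁ (to e a) ; (inj₂ c) → inj₂ (to f c) })
  (λ { (inj₁ b) → inj₁ (from e b) ; (inj₂ d) → inj₂ (from f d) })
  (λ { (inj₁ b) → cong inj₁ (to∘from e b) ; (inj₂ d) → cong inj₂ (to∘from f d) })
  (λ { (inj₁ a) → cong inj₁ (from∘to e a) ; (inj₂ c) → cong inj₂ (from∘to f c) })
  (λ { (inj₁ a) → weight≃ e a ; (inj₂ c) → weight≃ f c })

⊕-comm : ∀ A B → A ⊕ B ≃ B ⊕ A
⊕-comm A B = iso (λ { (inj₁ a) → inj₂ a ; (inj₂ b) → inj₁ b })
  (λ { (inj₁ b) → inj₂ b ; (inj₂ a) → inj₁ a })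
  (λ { (inj₁ _) → refl ; (inj₂ _) → refl }) (λ { (inj₁ _) → refl ; (inj₂ _) → refl })
  (λ { (inj₁ _) → ↭-refl ; (inj₂ _) → ↭-refl })

⊕-assoc : ∀ A B C → (A ⊕ B) ⊕ C ≃ A ⊕ (B ⊕ C)
⊕-assoc A B C = iso
  (λ { (inj₁ (inj₁ a)) → inj₁ a ; (inj₁ (inj₂ b)) → inj₂ (inj₁ b) ; (inj₂ c) → inj₂ (inj₂ c) })
  (λ { (inj₁ a) → inj₁ (inj₁ a) ; (inj₂ (inj₁ b)) → inj₁ (inj₂ b) ; (inj₂ (inj₂ c)) → inj₂ c })
  (λ { (inj₁ _) → refl ; (inj₂ (inj₁ _)) → refl ; (inj₂ (inj₂ _)) → refl })
  (λ { (inj₁ (inj₁ _)) → refl ; (inj₁ (inj₂ _)) → refl ; (inj₂ _) → refl })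
  (λ { (inj₁ (inj₁ _)) → ↭-refl ; (inj₁ (inj₂ _)) → ↭-refl ; (inj₂ _) → ↭-refl })

⊕-identityˡ : ∀ A → 𝟘 ⊕ A ≃ A
⊕-identityˡ A = iso (λ { (inj₂ a) → a }) inj₂ (λ _ → refl) (λ { (inj₂ _) → refl })
  (λ { (inj₂ _) → ↭-refl })

⊗-distribʳ-⊕ : ∀ C A B → (A ⊕ B) ⊗ C ≃ (A ⊗ C) ⊕ (B ⊗ C)
⊗-distribʳ-⊕ C A B = iso
  (λ { (inj₁ a , c) → inj₁ (a , c) ; (inj₂ b , c) → inj₂ (b , c) })
  (λ { (inj₁ (a , c)) → inj₁ a , c ; (inj₂ (b , c)) → inj₂ b , c })
  (λ { (inj₁ _) → refl ; (inj₂ _) → refl })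
  (λ { (inj₁ _ , _) → refl ; (inj₂ _ , _) → refl })
  (λ { (inj₁ _ , _) → ↭-refl ; (inj₂ _ , _) → ↭-refl })

empty≃ : ∀ {A B} → (Carrier A → ⊥) → (Carrier B → ⊥) → A ≃ B
empty≃ p q = iso (⊥-elim ∘ p) (⊥-elim ∘ q) (⊥-elim ∘ q) (⊥-elim ∘ p) (⊥-elim ∘ p)

≃-isEquivalence : IsEquivalence _≃_
≃-isEquivalence = record { refl = ≃-refl ; sym = ≃-sym ; trans = ≃-trans }

-- Feeds the semiring solver, which turns a rearrangement of polynomials into an explicit
-- isomorphism.
semiring : CommutativeSemiring _ _
semiring = record
  { Carrier = WSet ; _≈_ = _≃_ ; _+_ = _⊕_ ; _*_ = _⊗_ ; 0# = 𝟘 ; 1# = 𝟙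
  ; isCommutativeSemiring = IsCommutativeSemiringˡ.isCommutativeSemiring record
    { +-isCommutativeMonoid = record
      { isMonoid = record
        { isSemigroup = record
          { isMagma = record { isEquivalence = ≃-isEquivalence ; ∙-cong = ⊕-cong }
          ; assoc = ⊕-assoc }
        ; identity = ⊕-identityˡ , λ A → ≃-trans (⊕-comm A 𝟘) (⊕-identityˡ A) }
      ; comm = ⊕-comm }
    ; *-isCommutativeMonoid = record
      { isMonoid = record
        { isSemigroup = record
          { isMagma = record { isEquivalence = ≃-isEquivalence ; ∙-cong = ⊗-cong }
          ; assoc = ⊗-assoc }
        ; identity = ⊗-identityˡ , λ A → ≃-trans (⊗-comm A 𝟙) (⊗-identityˡ A) }
      ; comm = ⊗-comm }
    ; distribʳ = ⊗-distribʳ-⊕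
    ; zeroˡ = λ A → empty≃ (λ { (() , _) }) (λ ())
    }
  }

open SemiringSolver semiring using (solve; con; _:=_; _:+_; _:*_)
open SetoidReasoning (CommutativeSemiring.setoid semiring)

-- Indexed sums and cancellation of monomials.

∑-cong : ∀ {I F G} → (∀ i → F i ≃ G i) → ∑ I F ≃ ∑ I G
∑-cong e = iso (λ { (i , a) → i , to (e i) a }) (λ { (i , a) → i , from (e i) a })
  (λ { (i , a) → cong (i ,_) (to∘from (e i) a) })
  (λ { (i , a) → cong (i ,_) (from∘to (e i) a) })
  (λ { (i , a) → weight≃ (e i) a })

∑-swap : ∀ I J (F : I → J → WSet) → ∑ I (λ i → ∑ J (F i)) ≃ ∑ J (λ j → ∑ I (λ i → F i j))
∑-swap I J F = iso (λ { (i , j , a) → j , i , a }) (λ { (j , i , a) → i , j , a })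
  (λ _ → refl) (λ _ → refl) (λ _ → ↭-refl)

⊗-distribˡ-∑ : ∀ A I (F : I → WSet) → A ⊗ ∑ I F ≃ ∑ I (λ i → A ⊗ F i)
⊗-distribˡ-∑ A I F = iso (λ { (a , i , b) → i , a , b }) (λ { (i , a , b) → a , i , b })
  (λ _ → refl) (λ _ → refl) (λ _ → ↭-refl)

⊗-distribʳ-∑ : ∀ A I (F : I → WSet) → ∑ I F ⊗ A ≃ ∑ I (λ i → F i ⊗ A)
⊗-distribʳ-∑ A I F = iso (λ { ((i , b) , a) → i , b , a }) (λ { (i , b , a) → (i , b) , a })
  (λ _ → refl) (λ _ → refl) (λ _ → ↭-refl)

∑-point : ∀ {I : Set} i (F : I → WSet) → ∑ I (λ j → guard (i ≡ j) ⊗ F j) ≃ F i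
∑-point i F = iso (λ { (_ , refl , a) → a }) (λ a → i , refl , a) (λ _ → refl)
  (λ { (_ , refl , _) → refl }) (λ { (_ , refl , _) → ↭-refl })

∑-split : ∀ {n} (F : Vec Bool (suc n) → WSet) →
  ∑ (Vec Bool (suc n)) F ≃
  ∑ (Vec Bool n) (λ K → F (false ∷ K)) ⊕ ∑ (Vec Bool n) (λ K → F (true ∷ K))
∑-split F = iso
  (λ { (false ∷ K , a) → inj₁ (K , a) ; (true ∷ K , a) → inj₂ (K , a) })
  (λ { (inj₁ (K , a)) → false ∷ K , a ; (inj₂ (K , a)) → true ∷ K , a })
  (λ { (inj₁ _) → refl ; (inj₂ _) → refl })
  (λ { (false ∷ _ , _) → refl ; (true ∷ _ , _) → refl })
  (λ { (false ∷ _ , _) → ↭-refl ; (true ∷ _ , _) → ↭-refl })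

mono-∷ : ∀ v l → mono (v ∷ l) ≃ mono (v ∷ []) ⊗ mono l
mono-∷ v l = iso (λ _ → tt , tt) (λ _ → tt) (λ _ → refl) (λ _ → refl) (λ _ → ↭-refl)

++-cancelˡ-↭ : ∀ (l : List Var) {l₁ l₂} → l ++ l₁ ↭ l ++ l₂ → l₁ ↭ l₂
++-cancelˡ-↭ []      p = p
++-cancelˡ-↭ (_ ∷ l) p = ++-cancelˡ-↭ l (drop-∷ p)

-- The carrier of `mono l` is a single point, so a bijection of the products already is one of the
-- factors; only the weights have a common part to cancel.
mono-cancelˡ : ∀ l {A B} → mono l ⊗ A ≃ mono l ⊗ B → A ≃ B
mono-cancelˡ l e = iso (λ a → proj₂ (to e (tt , a))) (λ b → proj₂ (from e (tt , b)))
  (λ b → cong proj₂ (to∘from e (tt , b))) (λ a → cong proj₂ (from∘to e (tt , a)))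
  (λ a → ++-cancelˡ-↭ l (weight≃ e (tt , a)))

-- Columns as transfer matrices.

Mat : ℕ → Set₁
Mat n = Vec Bool n → Vec Bool n → WSet

-- The horizontal edge bits between two columns are listed from the bottom row
-- to the top row.  The first Boolean argument of each column below is the bit
-- on its bottommost vertical edge; the topmost vertical edge is empty.
colX colY : WSet → Bool → ∀ {n} → Mat n
colX u false []          []          = 𝟙
colX u true  []          []          = 𝟘
colX u false (false ∷ H) (false ∷ K) = colX u false H K
colX u false (true  ∷ H) (false ∷ K) = u ⊗ colX u true H K
colX u false (true  ∷ H) (true  ∷ K) = colX u false H K
colX u false (false ∷ H) (true  ∷ K) = 𝟘
colX u true  (false ∷ H) (false ∷ K) = u ⊗ colX u true H K
colX u true  (false ∷ H) (true  ∷ K) = colX u false H K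
colX u true  (true  ∷ H) (k     ∷ K) = 𝟘

colY v false []          []          = 𝟙
colY v true  []          []          = 𝟘
colY v false (false ∷ H) (false ∷ K) = colY v false H K
colY v false (true  ∷ H) (false ∷ K) = v ⊗ colY v true H K
colY v false (true  ∷ H) (true  ∷ K) = colY v false H K
colY v false (false ∷ H) (true  ∷ K) = 𝟘
colY v true  (false ∷ H) (true  ∷ K) = colY v false H K
colY v true  (true  ∷ H) (true  ∷ K) = v ⊗ colY v true H K
colY v true  (h     ∷ H) (false ∷ K) = 𝟘

-- All six vertices occur here, whereas `colX` and `colY` each exclude one. The three vertices with
-- an occupied edge above carry the three types of entry: `u` for type (i), `v` for type (ii),
-- `u ⊕ v` for type (iii).
colYX : WSet → WSet → Bool → ∀ {n} → Mat n
colYX u v false []          []          = 𝟙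
colYX u v true  []          []          = 𝟘
colYX u v false (false ∷ H) (false ∷ K) = colYX u v false H K
colYX u v false (true  ∷ H) (false ∷ K) = (u ⊕ v) ⊗ colYX u v true H K
colYX u v false (true  ∷ H) (true  ∷ K) = colYX u v false H K
colYX u v false (false ∷ H) (true  ∷ K) = 𝟘
colYX u v true  (false ∷ H) (false ∷ K) = u ⊗ colYX u v true H K
colYX u v true  (false ∷ H) (true  ∷ K) = colYX u v false H K
colYX u v true  (true  ∷ H) (false ∷ K) = 𝟘
colYX u v true  (true  ∷ H) (true  ∷ K) = v ⊗ colYX u v true H K

-- Matrix products and sums over the lowest bit.

infixr 7 _∙_

_∙_ : ∀ {n} → Mat n → Mat n → Mat n
(M ∙ N) H K = ∑ (Vec Bool _) λ J → M H J ⊗ N J K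

EmptyAt : ∀ {n} → (Vec Bool n → WSet) → Set
EmptyAt F = ∀ K → Carrier (F K) → ⊥

∑-false : ∀ {n} (F : Vec Bool (suc n) → WSet) → EmptyAt (λ K → F (true ∷ K)) →
  ∑ (Vec Bool (suc n)) F ≃ ∑ (Vec Bool n) (λ K → F (false ∷ K))
∑-false F e = iso
  (λ { (false ∷ K , a) → K , a ; (true ∷ K , a) → ⊥-elim (e K a) })
  (λ { (K , a) → false ∷ K , a }) (λ _ → refl)
  (λ { (false ∷ _ , _) → refl ; (true ∷ K , a) → ⊥-elim (e K a) })
  (λ { (false ∷ _ , _) → ↭-refl ; (true ∷ K , a) → ⊥-elim (e K a) })

∑-true : ∀ {n} (F : Vec Bool (suc n) → WSet) → EmptyAt (λ K → F (false ∷ K)) →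
  ∑ (Vec Bool (suc n)) F ≃ ∑ (Vec Bool n) (λ K → F (true ∷ K))
∑-true F e = iso
  (λ { (true ∷ K , a) → K , a ; (false ∷ K , a) → ⊥-elim (e K a) })
  (λ { (K , a) → true ∷ K , a }) (λ _ → refl)
  (λ { (true ∷ _ , _) → refl ; (false ∷ K , a) → ⊥-elim (e K a) })
  (λ { (true ∷ _ , _) → ↭-refl ; (false ∷ K , a) → ⊥-elim (e K a) })

∑-none : ∀ {n} (F : Vec Bool (suc n) → WSet) → EmptyAt (λ K → F (false ∷ K)) →
  EmptyAt (λ K → F (true ∷ K)) → ∑ (Vec Bool (suc n)) F ≃ 𝟘
∑-none F e e′ = empty≃ (λ { (false ∷ K , a) → e K a ; (true ∷ K , a) → e′ K a }) (λ ())

∑[]≃ : ∀ (F : Vec Bool 0 → WSet) → ∑ (Vec Bool 0) F ≃ F []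
∑[]≃ F = iso (λ { ([] , a) → a }) ([] ,_) (λ _ → refl) (λ { ([] , _) → refl })
  (λ { ([] , _) → ↭-refl })

∑-scaleˡ : ∀ {n} c (F G : Vec Bool n → WSet) →
  ∑ (Vec Bool n) (λ K → (c ⊗ F K) ⊗ G K) ≃ c ⊗ ∑ (Vec Bool n) (λ K → F K ⊗ G K)
∑-scaleˡ c F G = ≃-trans (∑-cong λ K → ⊗-assoc c (F K) (G K)) (≃-sym (⊗-distribˡ-∑ c _ _))

∑-scaleʳ : ∀ {n} c (F G : Vec Bool n → WSet) →
  ∑ (Vec Bool n) (λ K → F K ⊗ (c ⊗ G K)) ≃ c ⊗ ∑ (Vec Bool n) (λ K → F K ⊗ G K)
∑-scaleʳ c F G = ≃-trans
  (∑-cong λ K → solve 3 (λ f d g → f :* (d :* g) := d :* (f :* g)) ≃-refl (F K) c (G K))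
  (≃-sym (⊗-distribˡ-∑ c _ _))

-- Factorisation of a column and the exchange relation.

module _ (u v : WSet) where

  private
    YX : Bool → Bool → ∀ {n} → Mat n
    YX a b = colY v a ∙ colX u b

    XY : Bool → Bool → ∀ {n} → Mat n
    XY a b = colX u a ∙ colY v b

    scaleX : ∀ a b {n} (H K : Vec Bool n) →
      ∑ (Vec Bool n) (λ J → colY v a H J ⊗ (u ⊗ colX u b J K)) ≃ u ⊗ YX a b H K
    scaleX a b H K = ∑-scaleʳ u (colY v a H) (λ J → colX u b J K)

    scaleY : ∀ a b {n} (H K : Vec Bool n) →
      ∑ (Vec Bool n) (λ J → (v ⊗ colY v a H J) ⊗ colX u b J K) ≃ v ⊗ YX a b H K
    scaleY a b H K = ∑-scaleˡ v (colY v a H) (λ J → colX u b J K)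

  -- `colY` would force the lowest bit between the two columns to be `true`, and `colX` would force
  -- it to be `false`.
  YX-tt : ∀ {n} (H K : Vec Bool n) → Carrier (YX true true H K) → ⊥
  YX-tt []          []          ([] , () , _)
  YX-tt (false ∷ H) (_ ∷ K)     (false ∷ _ , () , _)
  YX-tt (true ∷ H)  (_ ∷ K)     (false ∷ _ , () , _)
  YX-tt (_ ∷ H)     (_ ∷ K)     (true ∷ _ , _ , ())

  mutual
    -- The two columns merge into one whose vertical edge is occupied when either of theirs is.
    -- `YX-tt` excludes both at once, so three pairs of bits remain, and the induction climbs row by
    -- row through all of them.
    YX≃-ff : ∀ {n} (H K : Vec Bool n) → YX false false H K ≃ colYX u v false H K
    YX≃-ff [] [] = ≃-trans (∑[]≃ _) (⊗-identityˡ 𝟙)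
    YX≃-ff (false ∷ H) (false ∷ K) = ≃-trans (∑-false _ λ _ → proj₁) (YX≃-ff H K)
    YX≃-ff (false ∷ H) (true ∷ K) = ∑-none _ (λ _ → proj₂) (λ _ → proj₁)
    YX≃-ff (true ∷ H) (true ∷ K) = ≃-trans (∑-true _ λ _ → proj₂) (YX≃-ff H K)
    YX≃-ff (true ∷ H) (false ∷ K) = begin
      YX false false (true ∷ H) (false ∷ K)
        ≈⟨ ∑-split _ ⟩
      _ ⊕ _
        -- The middle bit `false` puts the new entry into the `Y` column, the middle bit `true` into
        -- the `X` column.
        ≈⟨ ⊕-cong (≃-trans (scaleY true false H K) (⊗-congʳ v (YX≃-tf H K)))
                  (≃-trans (scaleX false true H K) (⊗-congʳ u (YX≃-ft H K))) ⟩
      (v ⊗ colYX u v true H K) ⊕ (u ⊗ colYX u v true H K)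
        ≈⟨ solve 3 (λ a b c → b :* c :+ a :* c := (a :+ b) :* c) ≃-refl u v _ ⟩
      (u ⊕ v) ⊗ colYX u v true H K ∎

    YX≃-tf : ∀ {n} (H K : Vec Bool n) → YX true false H K ≃ colYX u v true H K
    YX≃-tf [] [] = ≃-trans (∑[]≃ _) (empty≃ proj₁ (λ ()))
    YX≃-tf (false ∷ H) (false ∷ K) = ≃-trans (∑-true _ λ _ → proj₁)
      (≃-trans (scaleX false true H K) (⊗-congʳ u (YX≃-ft H K)))
    YX≃-tf (false ∷ H) (true ∷ K) = ≃-trans (∑-true _ λ _ → proj₁) (YX≃-ff H K)
    YX≃-tf (true ∷ H) (false ∷ K) = ≃-trans (∑-true _ λ _ → proj₁)
      (empty≃ (λ { (J , (_ , c) , (_ , d)) → YX-tt H K (J , c , d) }) (λ ()))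
    YX≃-tf (true ∷ H) (true ∷ K) = ≃-trans (∑-true _ λ _ → proj₁)
      (≃-trans (scaleY true false H K) (⊗-congʳ v (YX≃-tf H K)))

    YX≃-ft : ∀ {n} (H K : Vec Bool n) → YX false true H K ≃ colYX u v true H K
    YX≃-ft [] [] = ≃-trans (∑[]≃ _) (empty≃ proj₂ (λ ()))
    YX≃-ft (false ∷ H) (false ∷ K) = ≃-trans (∑-false _ λ _ → proj₁)
      (≃-trans (scaleX false true H K) (⊗-congʳ u (YX≃-ft H K)))
    YX≃-ft (false ∷ H) (true ∷ K) = ≃-trans (∑-false _ λ _ → proj₁) (YX≃-ff H K)
    YX≃-ft (true ∷ H) (false ∷ K) = ≃-trans (∑-false _ λ _ → proj₂)
      (empty≃ (λ { (J , (_ , c) , (_ , d)) → YX-tt H K (J , c , d) }) (λ ()))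
    YX≃-ft (true ∷ H) (true ∷ K) = ≃-trans (∑-false _ λ _ → proj₂)
      (≃-trans (scaleY true false H K) (⊗-congʳ v (YX≃-tf H K)))

  private
    scaleX′ : ∀ a b {n} (H K : Vec Bool n) →
      ∑ (Vec Bool n) (λ J → (u ⊗ colX u a H J) ⊗ colY v b J K) ≃ u ⊗ XY a b H K
    scaleX′ a b H K = ∑-scaleˡ u (colX u a H) (λ J → colY v b J K)

    scaleY′ : ∀ a b {n} (H K : Vec Bool n) →
      ∑ (Vec Bool n) (λ J → colX u a H J ⊗ (v ⊗ colY v b J K)) ≃ v ⊗ XY a b H K
    scaleY′ a b H K = ∑-scaleʳ v (colX u a H) (λ J → colY v b J K)

    -- In this order the pairs `true false` and `false true` have different sums. A vertex that
    -- starts a new entry yields this combination of them, which is proportional to the merged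
    -- column.
    either : ∀ {n} (H K : Vec Bool n) → WSet
    either H K = (u ⊗ XY true false H K) ⊕ (v ⊗ XY false true H K)

  mutual
    XY≃-ff : ∀ {n} (H K : Vec Bool n) → XY false false H K ≃ colYX u v false H K
    XY≃-ff [] [] = ≃-trans (∑[]≃ _) (⊗-identityˡ 𝟙)
    XY≃-ff (false ∷ H) (false ∷ K) = ≃-trans (∑-false _ λ _ → proj₁) (XY≃-ff H K)
    XY≃-ff (false ∷ H) (true ∷ K) = ∑-none _ (λ _ → proj₂) (λ _ → proj₁)
    XY≃-ff (true ∷ H) (true ∷ K) = ≃-trans (∑-true _ λ _ → proj₂) (XY≃-ff H K)
    XY≃-ff (true ∷ H) (false ∷ K) = ≃-trans (∑-split _)
      (≃-trans (⊕-cong (scaleX′ true false H K) (scaleY′ false true H K)) (either≃ H K))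

    XY-tf-ff : ∀ {n} (H K : Vec Bool n) → XY true false (false ∷ H) (false ∷ K) ≃ either H K
    XY-tf-ff H K = ≃-trans (∑-split _) (⊕-cong (scaleX′ true false H K) (scaleY′ false true H K))

    XY-ft-tt : ∀ {n} (H K : Vec Bool n) → XY false true (true ∷ H) (true ∷ K) ≃ either H K
    XY-ft-tt H K = ≃-trans (∑-split _) (⊕-cong (scaleX′ true false H K) (scaleY′ false true H K))

    -- Equal bits on the two sides kill one summand and reproduce the combination from the other,
    -- with a factor `u` or `v`. A change from `false` to `true` ends the entry in both summands;
    -- the opposite change is impossible.
    either≃ : ∀ {n} (H K : Vec Bool n) → either H K ≃ (u ⊕ v) ⊗ colYX u v true H K
    either≃ [] [] = empty≃
      (λ { (inj₁ (_ , [] , () , _)) ; (inj₂ (_ , [] , _ , ())) }) (λ { (_ , ()) })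
    either≃ (false ∷ H) (false ∷ K) = begin
      either (false ∷ H) (false ∷ K)
        ≈⟨ ⊕-cong (⊗-congʳ u (≃-trans (XY-tf-ff H K) (either≃ H K)))
                  (⊗-congʳ v (∑-none _ (λ _ → proj₂) (λ _ → proj₁))) ⟩
      (u ⊗ ((u ⊕ v) ⊗ C)) ⊕ (v ⊗ 𝟘)
        ≈⟨ solve 3 (λ a b c → a :* ((a :+ b) :* c) :+ b :* con 0 := (a :+ b) :* (a :* c))
             ≃-refl u v C ⟩
      (u ⊕ v) ⊗ (u ⊗ C) ∎
      where C = colYX u v true H K
    either≃ (false ∷ H) (true ∷ K) = begin
      either (false ∷ H) (true ∷ K)
        ≈⟨ ⊕-cong (⊗-congʳ u (≃-trans (∑-true _ (λ _ → proj₂)) (XY≃-ff H K)))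
                  (⊗-congʳ v (≃-trans (∑-false _ (λ _ → proj₁)) (XY≃-ff H K))) ⟩
      (u ⊗ C) ⊕ (v ⊗ C)
        ≈⟨ ⊗-distribʳ-⊕ C u v ⟨
      (u ⊕ v) ⊗ C ∎
      where C = colYX u v false H K
    either≃ (true ∷ H) (false ∷ K) = empty≃
      (λ { (inj₁ (_ , _ ∷ _ , () , _))
         ; (inj₂ (_ , false ∷ _ , _ , ())) ; (inj₂ (_ , true ∷ _ , _ , ())) })
      (λ { (_ , ()) })
    either≃ (true ∷ H) (true ∷ K) = begin
      either (true ∷ H) (true ∷ K)
        ≈⟨ ⊕-cong (⊗-congʳ u (∑-none _ (λ _ → proj₁) (λ _ → proj₁)))
                  (⊗-congʳ v (≃-trans (XY-ft-tt H K) (either≃ H K))) ⟩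
      (u ⊗ 𝟘) ⊕ (v ⊗ ((u ⊕ v) ⊗ C))
        ≈⟨ solve 3 (λ a b c → a :* con 0 :+ b :* ((a :+ b) :* c) := (a :+ b) :* (b :* c))
             ≃-refl u v C ⟩
      (u ⊕ v) ⊗ (v ⊗ C) ∎
      where C = colYX u v true H K

  -- On the left, the set lowest bit makes the bottom row produce `either`, worth `(u ⊕ v) ⊗ C`; on
  -- the right, it carries the entry upwards with a single factor `v`. The additional `v` on the
  -- left balances the two.
  X∙Y≃Y∙X : ∀ {n} (H : Vec Bool n) (K : Vec Bool (suc n)) →
    v ⊗ (colX u false ∙ colY v true) (true ∷ H) K ≃
    (u ⊕ v) ⊗ (colY v true ∙ colX u false) (true ∷ H) K
  X∙Y≃Y∙X H (false ∷ K) = empty≃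
    (λ { (_ , false ∷ _ , _ , ()) ; (_ , true ∷ _ , _ , ()) })
    (λ { (_ , false ∷ _ , () , _)
       ; (_ , true ∷ J , (_ , c) , (_ , d)) → YX-tt H K (J , c , d) })
  X∙Y≃Y∙X H (true ∷ K) = begin
    v ⊗ XY false true (true ∷ H) (true ∷ K)
      ≈⟨ ⊗-congʳ v (≃-trans (XY-ft-tt H K) (either≃ H K)) ⟩
    v ⊗ ((u ⊕ v) ⊗ C)
      ≈⟨ solve 3 (λ a b c → b :* ((a :+ b) :* c) := (a :+ b) :* (b :* c)) ≃-refl u v C ⟩
    (u ⊕ v) ⊗ (v ⊗ C)
      ≈⟨ ⊗-congʳ (u ⊕ v) (YX≃-tf (true ∷ H) (true ∷ K)) ⟨
    (u ⊕ v) ⊗ YX true false (true ∷ H) (true ∷ K) ∎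
    where C = colYX u v true H K

-- Laws of the matrix product and chains of matrices.

∙-congˡ : ∀ {n} (M M′ N : Mat n) H K → (∀ J → M H J ≃ M′ H J) →
  (M ∙ N) H K ≃ (M′ ∙ N) H K
∙-congˡ M M′ N H K e = ∑-cong λ J → ⊗-congˡ (N J K) (e J)

∙-congʳ : ∀ {n} (M N N′ : Mat n) H K → (∀ J → N J K ≃ N′ J K) →
  (M ∙ N) H K ≃ (M ∙ N′) H K
∙-congʳ M N N′ H K e = ∑-cong λ J → ⊗-congʳ (M H J) (e J)

∙-assoc : ∀ {n} (M N P : Mat n) H K → ((M ∙ N) ∙ P) H K ≃ (M ∙ (N ∙ P)) H K
∙-assoc M N P H K = begin
  ((M ∙ N) ∙ P) H K
    ≈⟨ ∑-cong (λ J → ⊗-distribʳ-∑ (P J K) _ (λ I → M H I ⊗ N I J)) ⟩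
  ∑ _ (λ J → ∑ _ (λ I → (M H I ⊗ N I J) ⊗ P J K))
    ≈⟨ ∑-swap _ _ (λ J I → (M H I ⊗ N I J) ⊗ P J K) ⟩
  ∑ _ (λ I → ∑ _ (λ J → (M H I ⊗ N I J) ⊗ P J K))
    ≈⟨ ∑-cong (λ I → ∑-scaleˡ (M H I) (N I) (λ J → P J K)) ⟩
  (M ∙ (N ∙ P)) H K ∎

δ : ∀ {n} → Mat n
δ H K = guard (H ≡ K)

∙-identityˡ : ∀ {n} (M : Mat n) H K → (δ ∙ M) H K ≃ M H K
∙-identityˡ M H K = ∑-point H (λ J → M J K)

∙-identityʳ : ∀ {n} (M : Mat n) H K → (M ∙ δ) H K ≃ M H K
∙-identityʳ M H K = iso (λ { (_ , a , refl) → a }) (λ a → K , a , refl)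
  (λ _ → refl) (λ { (_ , _ , refl) → refl })
  (λ { (_ , _ , refl) → ↭-reflexive (sym (++-identityʳ _)) })

chain : ∀ {n} → (ℕ → Mat n) → ℕ → ℕ → Mat n
chain M s zero    = δ
chain M s (suc k) = M s ∙ chain M (suc s) k

chain-snoc : ∀ {n} (M : ℕ → Mat n) s k H K →
  chain M s (suc k) H K ≃ (chain M s k ∙ M (k + s)) H K
chain-snoc M s zero H K = ≃-trans (∙-identityʳ (M s) H K) (≃-sym (∙-identityˡ (M s) H K))
chain-snoc M s (suc k) H K = begin
  (M s ∙ chain M (suc s) (suc k)) H K
    ≈⟨ ∙-congʳ (M s) (chain M (suc s) (suc k)) (chain M (suc s) k ∙ M (k + suc s)) H K
         (λ J → chain-snoc M (suc s) k J K) ⟩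
  (M s ∙ (chain M (suc s) k ∙ M (k + suc s))) H K
    ≈⟨ ∙-assoc (M s) (chain M (suc s) k) (M (k + suc s)) H K ⟨
  (chain M s (suc k) ∙ M (k + suc s)) H K
    ≡⟨ cong (λ i → (chain M s (suc k) ∙ M i) H K) (+-suc k s) ⟩
  (chain M s (suc k) ∙ M (suc k + s)) H K ∎

chain-snoc₁ : ∀ {n} (M : ℕ → Mat n) k H K →
  chain M 1 (suc k) H K ≃ (chain M 1 k ∙ M (suc k)) H K
chain-snoc₁ M k H K = begin
  chain M 1 (suc k) H K           ≈⟨ chain-snoc M 1 k H K ⟩
  (chain M 1 k ∙ M (k + 1)) H K   ≡⟨ cong (λ i → (chain M 1 k ∙ M i) H K) (+-comm k 1) ⟩
  (chain M 1 k ∙ M (suc k)) H K   ∎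

-- Tournaments, and moving `Y` past a run of `X`.

var : Var → WSet
var v = mono (v ∷ [])

-- Every number occurs in the bottom row, so the edge below each column is occupied. The
-- factorisation gives that bit to `Y`, and `X` starts from an empty edge.
X Y C : ∀ {n} → ℕ → Mat n
X i = colX (var (x i)) false
Y j = colY (var (y j)) true
C i = colYX (var (x i)) (var (y i)) true

edges : ℕ → ℕ → ℕ → WSet
edges top s k = wset (Vec Dir k) (λ ds → edgeWeights top s (toList ds))

edges-zero : ∀ top s → edges top s 0 ≃ 𝟙
edges-zero top s = iso (λ _ → tt) (λ _ → []) (λ _ → refl) (λ { [] → refl }) (λ { [] → ↭-refl })

edges-suc : ∀ top s k → edges top s (suc k) ≃ (var (x s) ⊕ var (y top)) ⊗ edges top (suc s) k
edges-suc top s k = iso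
  (λ { (up ∷ ds) → inj₁ tt , ds ; (down ∷ ds) → inj₂ tt , ds })
  (λ { (inj₁ _ , ds) → up ∷ ds ; (inj₂ _ , ds) → down ∷ ds })
  (λ { (inj₁ _ , _) → refl ; (inj₂ _ , _) → refl })
  (λ { (up ∷ _) → refl ; (down ∷ _) → refl })
  (λ { (up ∷ _) → ↭-refl ; (down ∷ _) → ↭-refl })

tournaments : ℕ → WSet
tournaments m = wset (Tournament m) (tweight m)

tournaments-suc : ∀ m → tournaments (suc m) ≃ tournaments m ⊗ edges (suc m) 1 m
tournaments-suc m = iso (λ { (t , ds) → t , ds }) (λ { (t , ds) → t , ds })
  (λ _ → refl) (λ _ → refl) (λ _ → ↭-refl)

data Packed : ∀ {n} → ℕ → Vec Bool n → Set where
  zero : ∀ {n} {H : Vec Bool n} → Packed zero H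
  suc  : ∀ {n k} {H : Vec Bool n} → Packed k H → Packed (suc k) (true ∷ H)

-- Clearing a bit occupies the edge above it, which `colX` does not let meet a set bit on the left.
-- So of the `suc k` lowest bits only the last can be cleared.
colX-packed : ∀ u {n k} {H J : Vec Bool n} → Packed (suc k) H →
  Carrier (colX u false H J) → Packed k J
colX-packed u {k = zero}  p c = zero
colX-packed u {k = suc k} {J = true ∷ _}  (suc p) c = suc (colX-packed u p c)
colX-packed u {k = suc k} {J = false ∷ (_ ∷ _)} (suc (suc p)) (_ , ())

-- Each exchange spends one `y j`, yields the two directions of one edge, and needs the lowest bit
-- of its state set. As each `X` costs at most one packed bit, `k` of them last for `k` exchanges.
Y-past-Xs : ∀ j s k {n} (H K : Vec Bool n) → Packed k H →
  mono (replicate k (y j)) ⊗ (chain X s k ∙ Y j) H K ≃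
  edges j s k ⊗ (Y j ∙ chain X s k) H K
Y-past-Xs j s zero H K p = begin
  𝟙 ⊗ (δ ∙ Y j) H K
    ≈⟨ ⊗-cong (≃-sym (edges-zero j s)) (∙-identityˡ (Y j) H K) ⟩
  edges j s 0 ⊗ Y j H K
    ≈⟨ ⊗-congʳ _ (∙-identityʳ (Y j) H K) ⟨
  edges j s 0 ⊗ (Y j ∙ δ) H K ∎
Y-past-Xs j s (suc k) {suc n} H@(true ∷ H′) K p = begin
  mono (y j ∷ l) ⊗ ((X s ∙ Xs) ∙ Y j) H K
    ≈⟨ ⊗-cong (mono-∷ (y j) l) (∙-assoc (X s) Xs (Y j) H K) ⟩
  (v ⊗ mono l) ⊗ (X s ∙ (Xs ∙ Y j)) H K
    ≈⟨ ⊗-assoc v (mono l) _ ⟩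
  v ⊗ (mono l ⊗ (X s ∙ (Xs ∙ Y j)) H K)
    ≈⟨ ⊗-congʳ v (∑-scaleʳ (mono l) (X s H) (λ J → (Xs ∙ Y j) J K)) ⟨
  v ⊗ ∑ _ (λ J → X s H J ⊗ (mono l ⊗ (Xs ∙ Y j) J K))
    -- The induction hypothesis holds only for packed `J`; an element of `X s H J` provides that.
    ≈⟨ ⊗-congʳ v (∑-cong λ J → ⊗-congʳ-on (X s H J) λ c →
         Y-past-Xs j (suc s) k J K (colX-packed _ p c)) ⟩
  v ⊗ ∑ _ (λ J → X s H J ⊗ (D ⊗ (Y j ∙ Xs) J K))
    ≈⟨ ⊗-congʳ v (∑-scaleʳ D (X s H) (λ J → (Y j ∙ Xs) J K)) ⟩
  v ⊗ (D ⊗ (X s ∙ (Y j ∙ Xs)) H K)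
    ≈⟨ ⊗-congʳ v (⊗-congʳ D (∙-assoc (X s) (Y j) Xs H K)) ⟨
  v ⊗ (D ⊗ ((X s ∙ Y j) ∙ Xs) H K)
    ≈⟨ solve 3 (λ a b c → a :* (b :* c) := b :* (a :* c)) ≃-refl v D _ ⟩
  D ⊗ (v ⊗ ((X s ∙ Y j) ∙ Xs) H K)
    ≈⟨ ⊗-congʳ D (∑-scaleˡ v ((X s ∙ Y j) H) (λ J → Xs J K)) ⟨
  D ⊗ ∑ _ (λ J → (v ⊗ (X s ∙ Y j) H J) ⊗ Xs J K)
    ≈⟨ ⊗-congʳ D (∑-cong λ J → ⊗-congˡ (Xs J K) (X∙Y≃Y∙X u v H′ J)) ⟩
  D ⊗ ∑ _ (λ J → ((u ⊕ v) ⊗ (Y j ∙ X s) H J) ⊗ Xs J K)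
    ≈⟨ ⊗-congʳ D (∑-scaleˡ (u ⊕ v) ((Y j ∙ X s) H) (λ J → Xs J K)) ⟩
  D ⊗ ((u ⊕ v) ⊗ ((Y j ∙ X s) ∙ Xs) H K)
    ≈⟨ solve 3 (λ a b c → b :* (a :* c) := (a :* b) :* c) ≃-refl (u ⊕ v) D _ ⟩
  ((u ⊕ v) ⊗ D) ⊗ ((Y j ∙ X s) ∙ Xs) H K
    ≈⟨ ⊗-cong (≃-sym (edges-suc j s k)) (∙-assoc (Y j) (X s) Xs H K) ⟩
  edges j s (suc k) ⊗ (Y j ∙ (X s ∙ Xs)) H K ∎
  where
  u = var (x s)
  v = var (y j)
  l = replicate k (y j)
  D = edges j (suc s) k
  Xs : Mat (suc n)
  Xs = chain X (suc s) k

-- Packed states and the product of all columns.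

ones : ℕ → ∀ n → Vec Bool n
ones m       zero    = []
ones zero    (suc n) = false ∷ ones zero n
ones (suc m) (suc n) = true ∷ ones m n

ones-packed : ∀ {m n} → m ≤ n → Packed m (ones m n)
ones-packed z≤n     = zero
ones-packed (s≤s p) = suc (ones-packed p)

δ-∷ : ∀ b {n} {H K : Vec Bool n} → δ H K ≃ δ (b ∷ H) (b ∷ K)
δ-∷ b = iso (cong (b ∷_)) (λ { refl → refl }) (λ { refl → refl }) (λ { refl → refl }) (λ _ → ↭-refl)

colY-zeros : ∀ v {n} (K : Vec Bool n) → colY v false (ones 0 n) K ≃ δ (ones 0 n) K
colY-zeros v []          = iso (λ _ → refl) (λ _ → tt) (λ { refl → refl }) (λ _ → refl) (λ _ → ↭-refl)
colY-zeros v (false ∷ K) = ≃-trans (colY-zeros v K) (δ-∷ false)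
colY-zeros v (true ∷ K)  = empty≃ (λ ()) (λ ())

-- The occupied edge rises through the `m` set bits, at weight `y j` each, and ends at the first
-- clear bit, which it sets; `m < n` ensures that there is one.
Y-ones : ∀ j {m n} → m < n → (K : Vec Bool n) →
  Y j (ones m n) K ≃ mono (replicate m (y j)) ⊗ δ (ones (suc m) n) K
Y-ones j {zero}  (s≤s p) (true ∷ K) = begin
  colY (var (y j)) false (ones 0 _) K          ≈⟨ colY-zeros _ K ⟩
  δ (ones 0 _) K                               ≈⟨ δ-∷ true ⟩
  δ (ones 1 _) (true ∷ K)                      ≈⟨ ⊗-identityˡ _ ⟨
  mono [] ⊗ δ (ones 1 _) (true ∷ K)            ∎
Y-ones j {suc m} (s≤s p) (true ∷ K) = begin
  var (y j) ⊗ Y j (ones m _) K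
    ≈⟨ ⊗-congʳ (var (y j)) (Y-ones j p K) ⟩
  var (y j) ⊗ (mono (replicate m (y j)) ⊗ δ (ones (suc m) _) K)
    ≈⟨ ⊗-assoc (var (y j)) (mono (replicate m (y j))) (δ (ones (suc m) _) K) ⟨
  (var (y j) ⊗ mono (replicate m (y j))) ⊗ δ (ones (suc m) _) K
    ≈⟨ ⊗-cong (≃-sym (mono-∷ (y j) _)) (δ-∷ true) ⟩
  mono (replicate (suc m) (y j)) ⊗ δ (ones (suc (suc m)) _) (true ∷ K) ∎
Y-ones j {zero}  (s≤s p) (false ∷ K) = empty≃ (λ ()) (λ { (_ , ()) })
Y-ones j {suc m} (s≤s p) (false ∷ K) = empty≃ (λ ()) (λ { (_ , ()) })

module _ {m n} (m<n : m < n) (K : Vec Bool n) where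

  private
    l = replicate m (y (suc m))
    D = edges (suc m) 1 m
    H = ones m n
    H′ = ones (suc m) n
    Xs Xs′ Y′ X′ C′ : Mat n
    Xs  = chain X 1 m
    Xs′ = chain X 1 (suc m)
    Y′  = Y (suc m)
    X′  = X (suc m)
    C′  = C (suc m)

  -- The monomial `l` spent on moving `Y′` to the front comes back when `Y′` acts on `ones m n`, so
  -- it appears on both sides and cancels.
  Xs∙C : (Xs ∙ C′) H K ≃ D ⊗ Xs′ H′ K
  Xs∙C = mono-cancelˡ l (begin
    mono l ⊗ (Xs ∙ C′) H K
      ≈⟨ ⊗-congʳ (mono l) (∙-congʳ Xs (Y′ ∙ X′) C′ H K λ J →
           YX≃-tf (var (x (suc m))) (var (y (suc m))) J K) ⟨
    mono l ⊗ (Xs ∙ (Y′ ∙ X′)) H K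
      ≈⟨ ⊗-congʳ (mono l) (∙-assoc Xs Y′ X′ H K) ⟨
    mono l ⊗ ((Xs ∙ Y′) ∙ X′) H K
      ≈⟨ ∑-scaleˡ (mono l) ((Xs ∙ Y′) H) (λ J → X′ J K) ⟨
    ∑ _ (λ J → (mono l ⊗ (Xs ∙ Y′) H J) ⊗ X′ J K)
      ≈⟨ ∑-cong (λ J → ⊗-congˡ (X′ J K) (Y-past-Xs (suc m) 1 m H J (ones-packed (<⇒≤ m<n)))) ⟩
    ∑ _ (λ J → (D ⊗ (Y′ ∙ Xs) H J) ⊗ X′ J K)
      ≈⟨ ∑-scaleˡ D ((Y′ ∙ Xs) H) (λ J → X′ J K) ⟩
    D ⊗ ((Y′ ∙ Xs) ∙ X′) H K
      ≈⟨ ⊗-congʳ D (∙-assoc Y′ Xs X′ H K) ⟩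
    D ⊗ (Y′ ∙ (Xs ∙ X′)) H K
      ≈⟨ ⊗-congʳ D (∙-congʳ Y′ Xs′ (Xs ∙ X′) H K λ J → chain-snoc₁ X m J K) ⟨
    D ⊗ (Y′ ∙ Xs′) H K
      ≈⟨ ⊗-congʳ D (∑-cong λ J → ⊗-congˡ (Xs′ J K) (Y-ones (suc m) m<n J)) ⟩
    D ⊗ ∑ _ (λ J → (mono l ⊗ δ H′ J) ⊗ Xs′ J K)
      ≈⟨ ⊗-congʳ D (∑-scaleˡ (mono l) (δ H′) (λ J → Xs′ J K)) ⟩
    D ⊗ (mono l ⊗ (δ ∙ Xs′) H′ K)
      ≈⟨ ⊗-congʳ D (⊗-congʳ (mono l) (∙-identityˡ Xs′ H′ K)) ⟩
    D ⊗ (mono l ⊗ Xs′ H′ K)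
      ≈⟨ solve 3 (λ a b c → a :* (b :* c) := b :* (a :* c)) ≃-refl D (mono l) _ ⟩
    mono l ⊗ (D ⊗ Xs′ H′ K) ∎)

-- Each further column contributes the edges from its vertex to all smaller ones and packs one more
-- bit.
chain-C : ∀ {m n} → m ≤ n → (K : Vec Bool n) →
  chain C 1 m (ones 0 n) K ≃ tournaments m ⊗ chain X 1 m (ones m n) K
chain-C {zero}  p K = ≃-sym (⊗-identityˡ _)
chain-C {suc m} {n} p K = begin
  Cs′ (ones 0 n) K
    ≈⟨ chain-snoc₁ C m (ones 0 n) K ⟩
  (Cs ∙ C (suc m)) (ones 0 n) K
    ≈⟨ ∑-cong (λ J → ⊗-congˡ (C (suc m) J K) (chain-C (<⇒≤ p) J)) ⟩
  ∑ _ (λ J → (T ⊗ Xs (ones m n) J) ⊗ C (suc m) J K)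
    ≈⟨ ∑-scaleˡ T (Xs (ones m n)) (λ J → C (suc m) J K) ⟩
  T ⊗ (Xs ∙ C (suc m)) (ones m n) K
    ≈⟨ ⊗-congʳ T (Xs∙C p K) ⟩
  T ⊗ (edges (suc m) 1 m ⊗ Xs′ (ones (suc m) n) K)
    ≈⟨ ⊗-assoc T (edges (suc m) 1 m) _ ⟨
  (T ⊗ edges (suc m) 1 m) ⊗ Xs′ (ones (suc m) n) K
    ≈⟨ ⊗-congˡ _ (tournaments-suc m) ⟨
  tournaments (suc m) ⊗ Xs′ (ones (suc m) n) K ∎
  where
  T = tournaments m
  Cs Cs′ Xs Xs′ : Mat n
  Cs  = chain C 1 m
  Cs′ = chain C 1 (suc m)
  Xs  = chain X 1 m
  Xs′ = chain X 1 (suc m)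

-- No bit can be cleared: the edge thus occupied would run into a set bit or leave through the top.
X-ones : ∀ u {n} (K : Vec Bool n) → colX u false (ones n n) K ≃ δ (ones n n) K
X-ones u []          = iso (λ _ → refl) (λ _ → tt) (λ { refl → refl }) (λ _ → refl) (λ _ → ↭-refl)
X-ones u (true ∷ K)  = ≃-trans (X-ones u K) (δ-∷ true)
X-ones u (false ∷ []) = empty≃ (λ { (_ , ()) }) (λ ())
X-ones u (false ∷ (_ ∷ _)) = empty≃ (λ { (_ , ()) }) (λ ())

Xs-ones : ∀ s k {n} → chain X s k (ones n n) (ones n n) ≃ 𝟙
Xs-ones s zero {n} = iso (λ _ → tt) (λ _ → refl) (λ _ → refl) (λ p → Vec-≡-irrelevant _ p) (λ _ → ↭-refl)
  where open Decidable⇒UIP (≡-dec Bool._≟_) renaming (≡-irrelevant to Vec-≡-irrelevant)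
Xs-ones s (suc k) {n} = begin
  (X s ∙ Xs) (ones n n) (ones n n)
    ≈⟨ ∙-congˡ (X s) δ Xs (ones n n) (ones n n) (X-ones (var (x s))) ⟩
  (δ ∙ Xs) (ones n n) (ones n n)
    ≈⟨ ∙-identityˡ Xs (ones n n) (ones n n) ⟩
  Xs (ones n n) (ones n n)
    ≈⟨ Xs-ones (suc s) k ⟩
  𝟙 ∎
  where
  Xs : Mat n
  Xs = chain X (suc s) k

-- Vertex configurations, by rows and by columns.

-- A row of a triangle, one cell per column: an entry is recorded by its
-- orientation, its value being the number of the column.
Cells : ℕ → Set
Cells = Vec (Maybe Orient)

decode : ℕ → ∀ {n} → Cells n → List (ℕ × Orient)
decode s []            = []
decode s (nothing ∷ B) = decode (suc s) B
decode s (just o ∷ B)  = (s , o) ∷ decode (suc s) B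

occupied : ∀ {n} → Cells n → Vec Bool n
occupied = Vec.map is-just

-- Next h v a k: the vertex with left edge h, cell v above, occupation a below
-- and right edge k, where h and k count (below minus above) the entries to the
-- left of the respective edge.
data Next : Bool → Maybe Orient → Bool → Bool → Set where
  skip₀ : Next false nothing  false false
  enter : Next false nothing  true  true
  skip₁ : Next true  nothing  false true
  pass  : Next false (just R) true  false
  leave : ∀ {o} → Next true (just o) false false
  swap  : Next true  (just L) true  true

-- The edge at the right end is set, because the row below has one entry more in total.
data Row : Bool → ∀ {n} → Cells n → Vec Bool n → Set where
  end  : Row true [] []
  step : ∀ {h v a k n} {B : Cells n} {A} → Next h v a k → Row k B A → Row h (v ∷ B) (a ∷ A)

data Vacant : ∀ {n} → Vec Bool n → Set where
  none : Vacant []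
  more : ∀ {n} {A : Vec Bool n} → Vacant A → Vacant (false ∷ A)

rowWeight : ℕ → ∀ {n} → Cells n → List Var
rowWeight s B = List.map entryVar (decode s B)

-- Configurations with left boundary `H` and bottom boundary `A`, built row by row from the bottom;
-- the vertical edges above the last row are empty.
grid : ℕ → ∀ {k n} → Vec Bool k → Vec Bool n → WSet
grid s []      A = guard (Vacant A)
grid s (h ∷ H) A = ∑ (Cells _) λ B →
  guard (Row h B A) ⊗ (mono (rowWeight s B) ⊗ grid s H (occupied B))

cellWeight : ℕ → Maybe Orient → List Var
cellWeight s v = rowWeight s (v ∷ [])

gridColumn : ℕ → Bool → ∀ {k} → Mat k
gridColumn s a []      []      = guard (a ≡ false)
gridColumn s a (h ∷ H) (k ∷ K) = ∑ (Maybe Orient) λ v →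
  guard (Next h v a k) ⊗ (mono (cellWeight s v) ⊗ gridColumn s (is-just v) H K)

-- The two orientations at `leave` make up the factor `u ⊕ v`; `pass` and `swap` give `u` and `v`.
gridColumn≃ : ∀ s a {k} (H K : Vec Bool k) →
  gridColumn s a H K ≃ colYX (var (x s)) (var (y s)) a H K
gridColumn≃ s false []          []          =
  iso (λ _ → tt) (λ _ → refl) (λ _ → refl) (λ { refl → refl }) (λ _ → ↭-refl)
gridColumn≃ s true  []          []          = empty≃ (λ ()) (λ ())
gridColumn≃ s false (false ∷ H) (false ∷ K) = ≃-trans
  (iso (λ { (nothing , skip₀ , _ , c) → c }) (λ c → nothing , skip₀ , tt , c)
    (λ _ → refl) (λ { (nothing , skip₀ , _ , c) → refl }) (λ { (nothing , skip₀ , _ , c) → ↭-refl }))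
  (gridColumn≃ s false H K)
gridColumn≃ s false (true ∷ H)  (false ∷ K) = ≃-trans
  (iso
    (λ { (just R , leave , _ , c) → inj₁ tt , c ; (just L , leave , _ , c) → inj₂ tt , c })
    (λ { (inj₁ _ , c) → just R , leave , tt , c ; (inj₂ _ , c) → just L , leave , tt , c })
    (λ { (inj₁ _ , c) → refl ; (inj₂ _ , c) → refl })
    (λ { (just R , leave , _ , c) → refl ; (just L , leave , _ , c) → refl })
    (λ { (just R , leave , _ , c) → ↭-refl ; (just L , leave , _ , c) → ↭-refl }))
  (⊗-congʳ (var (x s) ⊕ var (y s)) (gridColumn≃ s true H K))
gridColumn≃ s false (true ∷ H)  (true ∷ K)  = ≃-trans
  (iso (λ { (nothing , skip₁ , _ , c) → c }) (λ c → nothing , skip₁ , tt , c)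
    (λ _ → refl) (λ { (nothing , skip₁ , _ , c) → refl }) (λ { (nothing , skip₁ , _ , c) → ↭-refl }))
  (gridColumn≃ s false H K)
gridColumn≃ s false (false ∷ H) (true ∷ K)  = empty≃ (λ { (_ , () , _) }) (λ ())
gridColumn≃ s true  (false ∷ H) (false ∷ K) = ≃-trans
  (iso (λ { (just R , pass , _ , c) → tt , c }) (λ { (_ , c) → just R , pass , tt , c })
    (λ _ → refl) (λ { (just R , pass , _ , c) → refl }) (λ { (just R , pass , _ , c) → ↭-refl }))
  (⊗-congʳ (var (x s)) (gridColumn≃ s true H K))
gridColumn≃ s true  (false ∷ H) (true ∷ K)  = ≃-trans
  (iso (λ { (nothing , enter , _ , c) → c }) (λ c → nothing , enter , tt , c)
    (λ _ → refl) (λ { (nothing , enter , _ , c) → refl }) (λ { (nothing , enter , _ , c) → ↭-refl }))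
  (gridColumn≃ s false H K)
gridColumn≃ s true  (true ∷ H)  (false ∷ K) = empty≃ (λ { (_ , () , _) }) (λ ())
gridColumn≃ s true  (true ∷ H)  (true ∷ K)  = ≃-trans
  (iso (λ { (just L , swap , _ , c) → tt , c }) (λ { (_ , c) → just L , swap , tt , c })
    (λ _ → refl) (λ { (just L , swap , _ , c) → refl }) (λ { (just L , swap , _ , c) → ↭-refl }))
  (⊗-congʳ (var (y s)) (gridColumn≃ s true H K))

rowWeight-∷ : ∀ s v {n} (B : Cells n) → rowWeight s (v ∷ B) ≡ cellWeight s v ++ rowWeight (suc s) B
rowWeight-∷ s nothing  B = refl
rowWeight-∷ s (just o) B = refl

++-interchange : ∀ (a b c d : List Var) → (a ++ c) ++ (b ++ d) ↭ (a ++ b) ++ (c ++ d)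
++-interchange a b c d = ↭-trans (↭-reflexive (++-assoc a c (b ++ d)))
  (↭-trans (++⁺ˡ a (shifts c b)) (↭-reflexive (sym (++-assoc a b (c ++ d)))))

-- Passes from rows to columns: the leftmost column is cut off, and its right edges `K` become the
-- left boundary of the rest.
grid-peel : ∀ s {k n} (H : Vec Bool k) a (A : Vec Bool n) →
  grid s H (a ∷ A) ≃ ∑ (Vec Bool k) λ K → gridColumn s a H K ⊗ grid (suc s) K A
grid-peel s [] false A = iso (λ { (more p) → [] , refl , p }) (λ { ([] , _ , p) → more p })
  (λ { ([] , refl , _) → refl }) (λ { (more _) → refl }) (λ { (more _) → ↭-refl })
grid-peel s [] true A = empty≃ (λ ()) (λ { ([] , () , _) })
grid-peel s {suc k} {n} (h ∷ H) a A = ≃-trans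
  (∑-cong {G = peeled} λ { (v ∷ B) → ⊗-congʳ (guard (Row h (v ∷ B) (a ∷ A)))
    (⊗-congʳ (mono (rowWeight s (v ∷ B))) (grid-peel s H (is-just v) (occupied B))) })
  -- The first vertex of the bottom row joins the column, the remainder of that row joins the
  -- smaller grid.
  (iso
    (λ { (v ∷ B , step p r , _ , K , c , g) → _ ∷ K , (v , p , tt , c) , (B , r , tt , g) })
    (λ { (_ ∷ K , (v , p , tt , c) , (B , r , tt , g)) → v ∷ B , step p r , tt , K , c , g })
    (λ { (_ ∷ K , (v , p , tt , c) , (B , r , tt , g)) → refl })
    (λ { (v ∷ B , step p r , _ , K , c , g) → refl })
    (λ { (v ∷ B , step p r , _ , K , c , g) → ↭-trans
      (++-interchange (cellWeight s v) (rowWeight (suc s) B) (wc v K c) (wg B K g))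
      (↭-reflexive (cong (_++ (wc v K c ++ wg B K g)) (sym (rowWeight-∷ s v B)))) }))
  where
  wc = λ v K → weight (gridColumn s (is-just v) H K)
  wg = λ (B : Cells n) K → weight (grid (suc s) K (occupied B))
  peeled : Cells (suc n) → WSet
  peeled (v ∷ B) = guard (Row h (v ∷ B) (a ∷ A)) ⊗ (mono (rowWeight s (v ∷ B)) ⊗
    ∑ (Vec Bool k) λ K → gridColumn s (is-just v) H K ⊗ grid (suc s) K (occupied B))

-- Without columns the left boundary is also the right one, where every bit is set.
grid-[] : ∀ s {k} (H : Vec Bool k) → grid s H [] ≃ δ H (ones k k)
grid-[] s [] = iso (λ _ → refl) (λ _ → none) (λ { refl → refl }) (λ { none → refl }) (λ _ → ↭-refl)
grid-[] s (true ∷ H) = ≃-trans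
  (iso (λ { ([] , end , _ , g) → g }) (λ g → [] , end , tt , g)
    (λ _ → refl) (λ { ([] , end , _ , _) → refl }) (λ { ([] , end , _ , _) → ↭-refl }))
  (≃-trans (grid-[] s H) (δ-∷ true))
grid-[] s (false ∷ H) = empty≃ (λ { ([] , () , _) }) (λ ())

grid≃chain : ∀ s n {k} (H : Vec Bool k) → grid s H (ones n n) ≃ chain C s n H (ones k k)
grid≃chain s zero    H = grid-[] s H
grid≃chain s (suc n) H = ≃-trans (grid-peel s H true (ones n n))
  (∑-cong λ K → ⊗-cong (gridColumn≃ s true H K) (grid≃chain (suc s) n K))

-- Once all columns are used the state is full; every remaining `X` fixes it, so their chain
-- contributes `𝟙`.
grid≃tournaments : ∀ n → grid 1 (ones 0 n) (ones n n) ≃ tournaments n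
grid≃tournaments n = begin
  grid 1 (ones 0 n) (ones n n)
    ≈⟨ grid≃chain 1 n (ones 0 n) ⟩
  chain C 1 n (ones 0 n) (ones n n)
    ≈⟨ chain-C ≤-refl (ones n n) ⟩
  tournaments n ⊗ chain X 1 n (ones n n) (ones n n)
    ≈⟨ ⊗-congʳ (tournaments n) (Xs-ones 1 n) ⟩
  tournaments n ⊗ 𝟙
    ≈⟨ ≃-trans (⊗-comm _ 𝟙) (⊗-identityˡ _) ⟩
  tournaments n ∎

-- Rows of vertices and interlacing rows of numbers.

positions : ℕ → ∀ {n} → Vec Bool n → List ℕ
positions s []          = []
positions s (false ∷ A) = positions (suc s) A
positions s (true ∷ A)  = s ∷ positions (suc s) A

entries-decode : ∀ s {n} (B : Cells n) → entries (decode s B) ≡ positions s (occupied B)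
entries-decode s []            = refl
entries-decode s (nothing ∷ B) = entries-decode (suc s) B
entries-decode s (just o ∷ B)  = cong (s ∷_) (entries-decode (suc s) B)

positions-≥ : ∀ s {n} (A : Vec Bool n) → All (s ≤_) (positions s A)
positions-≥ s []          = []
positions-≥ s (false ∷ A) = All.map <⇒≤ (positions-≥ (suc s) A)
positions-≥ s (true ∷ A)  = ≤-refl ∷ All.map <⇒≤ (positions-≥ (suc s) A)

positions-< : ∀ s {n} (A : Vec Bool n) → All (_< s + n) (positions s A)
positions-< s []                  = []
positions-< s {suc n} (false ∷ A) rewrite +-suc s n = positions-< (suc s) A
positions-< s {suc n} (true ∷ A)  =
  m<m+n s (s≤s z≤n) ∷
  subst (λ t → All (_< t) (positions (suc s) A)) (sym (+-suc s n)) (positions-< (suc s) A)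

decode-≥ : ∀ s {n} (B : Cells n) → All (s ≤_) (entries (decode s B))
decode-≥ s B = subst (All (s ≤_)) (sym (entries-decode s B)) (positions-≥ s (occupied B))

Increasing-∷ : ∀ {a l} → All (a <_) l → Increasing l → Increasing (a ∷ l)
Increasing-∷ []      i = tt
Increasing-∷ (p ∷ _) i = p , i

Increasing⇒All : ∀ {a} l → Increasing (a ∷ l) → All (a <_) l
Increasing⇒All []      i       = []
Increasing⇒All (b ∷ l) (p , i) = p ∷ All.map (<-trans p) (Increasing⇒All l i)

Increasing-tail : ∀ {a} l → Increasing (a ∷ l) → Increasing l
Increasing-tail []      i       = tt
Increasing-tail (_ ∷ _) (_ , i) = i

positions-increasing : ∀ s {n} (A : Vec Bool n) → Increasing (positions s A)
positions-increasing s []          = tt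
positions-increasing s (false ∷ A) = positions-increasing (suc s) A
positions-increasing s (true ∷ A)  =
  Increasing-∷ (positions-≥ (suc s) A) (positions-increasing (suc s) A)

-- The list of entries below a row, from the column of the edge h on: if h is
-- set, the last entry before that column, which may be replaced by any smaller
-- number, is still to be compared with the next entry of the row.
below : Bool → ℕ → List ℕ → List ℕ
below false m l = l
below true  m l = m ∷ l

-- The first entry of the lower row bounds the upper row only from below.
Compat-lower : ∀ {m m′} r {l} → m ≤ m′ → Compat r (m′ ∷ l) → Compat r (m ∷ l)
Compat-lower []            {[]}    p c = tt
Compat-lower ((e , L) ∷ r) {b ∷ l} p (q , q′ , okL t , c) = ≤-trans p q , q′ , okL (≤-<-trans p t) , c
Compat-lower ((e , R) ∷ r) {b ∷ l} p (q , q′ , okR t , c) = ≤-trans p q , q′ , okR t , c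

-- Staying strictly below the upper row keeps the orientation `L` of its first entry allowed.
Compat-raise : ∀ {m m′} r {l} → All (m′ <_) (entries r) → Compat r (m ∷ l) → Compat r (m′ ∷ l)
Compat-raise []            {[]}    p       c = tt
Compat-raise ((e , L) ∷ r) {b ∷ l} (p ∷ _) (q , q′ , okL t , c) = <⇒≤ p , q′ , okL p , c
Compat-raise ((e , R) ∷ r) {b ∷ l} (p ∷ _) (q , q′ , okR t , c) = <⇒≤ p , q′ , okR t , c

Compat-∷ : ∀ {e b} o r l → Compat r l → All (e <_) l → b ≤ e → (∀ {d} → e < d → OrientOK b e d o) →
  Compat ((e , o) ∷ r) (b ∷ l)
Compat-∷ o []      []      () p q f
Compat-∷ o (_ ∷ _) []      () p q f
Compat-∷ o r       (_ ∷ l) c (p ∷ _) q f = q , <⇒≤ p , f p , c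

Compat-tail : ∀ {e o b} r l → Compat ((e , o) ∷ r) (b ∷ l) → Compat r l
Compat-tail r (_ ∷ l) (_ , _ , _ , c) = c

Compat-headL : ∀ {e b} r l → Compat ((e , L) ∷ r) (b ∷ l) → b < e
Compat-headL r (_ ∷ l) (_ , _ , okL t , _) = t

Row⇒Compat : ∀ m {h n} {B : Cells n} {A} → Row h B A →
  Compat (decode (suc m) B) (below h m (positions (suc m) A))
Row⇒Compat m end            = tt
Row⇒Compat m (step skip₀ r) = Row⇒Compat (suc m) r
Row⇒Compat m (step enter r) = Row⇒Compat (suc m) r
Row⇒Compat m (step {B = B} skip₁ r) =
  -- The induction hypothesis takes the pending entry to be `suc m`; it is lowered back to `m`.
  Compat-lower (decode (suc (suc m)) B) (n≤1+n m) (Row⇒Compat (suc m) r)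
Row⇒Compat m (step {A = A} pass r) =
  Compat-∷ R _ _ (Row⇒Compat (suc m) r) (positions-≥ _ A) ≤-refl okR
Row⇒Compat m (step {A = A} (leave {L}) r) =
  Compat-∷ L _ _ (Row⇒Compat (suc m) r) (positions-≥ _ A) (n≤1+n m) (λ _ → okL (n<1+n m))
Row⇒Compat m (step {A = A} (leave {R}) r) =
  Compat-∷ R _ _ (Row⇒Compat (suc m) r) (positions-≥ _ A) (n≤1+n m) okR
Row⇒Compat m (step swap r) = n≤1+n m , ≤-refl , okL (n<1+n m) , Row⇒Compat (suc m) r

¬Compat-above : ∀ {e o} r l → All (e <_) l → Compat ((e , o) ∷ r) l → ⊥
¬Compat-above r (b ∷ _ ∷ _) (p ∷ _) (q , _) = <-irrefl refl (<-≤-trans p q)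

¬Compat-between : ∀ {m s} r l → All (s <_) (entries r) → Compat r (m ∷ s ∷ l) → ⊥
¬Compat-between (_ ∷ r) l (p ∷ _) (_ , q , _) = <-irrefl refl (<-≤-trans p q)

-- Left edge, cell and occupation below determine the vertex. Combinations without a vertex violate
-- interlacing or the orientation rule.
Compat⇒Row : ∀ m h {n} (B : Cells n) A →
  Compat (decode (suc m) B) (below h m (positions (suc m) A)) → Row h B A
Compat⇒Row m false []            []          ()
Compat⇒Row m true  []            []          c = end
Compat⇒Row m false (nothing ∷ B) (false ∷ A) c = step skip₀ (Compat⇒Row (suc m) false B A c)
Compat⇒Row m true  (nothing ∷ B) (false ∷ A) c =
  step skip₁ (Compat⇒Row (suc m) true B A (Compat-raise _ (decode-≥ _ B) c))
Compat⇒Row m false (nothing ∷ B) (true ∷ A)  c = step enter (Compat⇒Row (suc m) true B A c)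
Compat⇒Row m true  (nothing ∷ B) (true ∷ A)  c = ⊥-elim (¬Compat-between _ _ (decode-≥ _ B) c)
Compat⇒Row m false (just o ∷ B)  (false ∷ A) c = ⊥-elim (¬Compat-above _ _ (positions-≥ _ A) c)
Compat⇒Row m true  (just o ∷ B)  (false ∷ A) c =
  step leave (Compat⇒Row (suc m) false B A (Compat-tail _ _ c))
Compat⇒Row m false (just L ∷ B)  (true ∷ A)  c = ⊥-elim (<-irrefl refl (Compat-headL _ _ c))
Compat⇒Row m false (just R ∷ B)  (true ∷ A)  c =
  step pass (Compat⇒Row (suc m) false B A (Compat-tail _ _ c))
Compat⇒Row m true  (just L ∷ B)  (true ∷ A)  (_ , _ , _ , c) =
  step swap (Compat⇒Row (suc m) true B A c)
Compat⇒Row m true  (just R ∷ B)  (true ∷ A)  (_ , _ , okR t , c) = ⊥-elim (<-irrefl refl t)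

-- Encoding increasing rows by cells.

Compat-≥ : ∀ {s} r l → All (s ≤_) l → Compat r l → All (s ≤_) (entries r)
Compat-≥ []      l           p       c = []
Compat-≥ (_ ∷ r) (b ∷ _ ∷ l) (p ∷ ps) (q , _ , _ , c) = ≤-trans p q ∷ Compat-≥ r _ ps c

Compat-< : ∀ {t} r l → All (_< t) l → Compat r l → All (_< t) (entries r)
Compat-< []      l           p            c = []
Compat-< (_ ∷ r) (_ ∷ b ∷ l) (_ ∷ p ∷ ps) (_ , q , _ , c) = ≤-<-trans q p ∷ Compat-< r _ (p ∷ ps) c

Compat-length : ∀ r l → Compat r l → length l ≡ suc (length r)
Compat-length []      (_ ∷ [])    c = refl
Compat-length (_ ∷ r) (_ ∷ _ ∷ l) (_ , _ , _ , c) = cong suc (Compat-length r _ c)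

decode-surjective : ∀ s n r → Increasing (entries r) → All (s ≤_) (entries r) →
  All (_< s + n) (entries r) → Σ (Cells n) λ B → decode s B ≡ r
decode-surjective s zero    []      i p q = [] , refl
decode-surjective s zero    (_ ∷ r) i (p ∷ _) (q ∷ _) =
  ⊥-elim (<-irrefl refl (<-≤-trans q (subst (_≤ _) (sym (+-identityʳ s)) p)))
decode-surjective s (suc n) []      i p q
  with B , eq ← decode-surjective (suc s) n [] tt [] [] = nothing ∷ B , eq
decode-surjective s (suc n) ((e , o) ∷ r) i (p ∷ ps) (q ∷ qs)
  rewrite +-suc s n with s ≟ e
... | yes refl with B , eq ← decode-surjective (suc s) n r (Increasing-tail _ i) (Increasing⇒All _ i) qs =
  just o ∷ B , cong (_ ∷_) eq
... | no s≢e with B , eq ← decode-surjective (suc s) n ((e , o) ∷ r) i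
      (≤∧≢⇒< p s≢e ∷ All.map (≤-<-trans p) (Increasing⇒All _ i)) (q ∷ qs) = nothing ∷ B , eq

decode-≢ : ∀ s {n} (B : Cells n) {o r} → decode (suc s) B ≡ (s , o) ∷ r → ⊥
decode-≢ s B eq with p ∷ _ ← subst (λ r → All (suc s ≤_) (entries r)) eq (decode-≥ (suc s) B) =
  <-irrefl refl p

decode-injective : ∀ s {n} (B B′ : Cells n) → decode s B ≡ decode s B′ → B ≡ B′
decode-injective s []            []             eq = refl
decode-injective s (nothing ∷ B) (nothing ∷ B′) eq = cong (nothing ∷_) (decode-injective (suc s) B B′ eq)
decode-injective s (nothing ∷ B) (just _ ∷ B′)  eq = ⊥-elim (decode-≢ s B eq)
decode-injective s (just _ ∷ B)  (nothing ∷ B′) eq = ⊥-elim (decode-≢ s B′ (sym eq))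
decode-injective s (just o ∷ B)  (just o′ ∷ B′) eq with ∷-injective eq
... | refl , eq′ = cong (just o ∷_) (decode-injective (suc s) B B′ eq′)

vacant⇒decode≡[] : ∀ s {n} (B : Cells n) → Vacant (occupied B) → decode s B ≡ []
vacant⇒decode≡[] s []            p     = refl
vacant⇒decode≡[] s (nothing ∷ B) (more p) = vacant⇒decode≡[] (suc s) B p

decode≡[]⇒vacant : ∀ s {n} (B : Cells n) → decode s B ≡ [] → Vacant (occupied B)
decode≡[]⇒vacant s []            eq = none
decode≡[]⇒vacant s (nothing ∷ B) eq = more (decode≡[]⇒vacant (suc s) B eq)

-- Uniqueness of proofs.

Vacant-irrelevant : ∀ {n} {A : Vec Bool n} (p q : Vacant A) → p ≡ q
Vacant-irrelevant none     none     = refl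
Vacant-irrelevant (more p) (more q) = cong more (Vacant-irrelevant p q)

Row-irrelevant : ∀ {h n} {B : Cells n} {A} (r r′ : Row h B A) → r ≡ r′
Row-irrelevant end            end             = refl
Row-irrelevant (step skip₀ r) (step skip₀ r′) = cong (step skip₀) (Row-irrelevant r r′)
Row-irrelevant (step enter r) (step enter r′) = cong (step enter) (Row-irrelevant r r′)
Row-irrelevant (step skip₁ r) (step skip₁ r′) = cong (step skip₁) (Row-irrelevant r r′)
Row-irrelevant (step pass r)  (step pass r′)  = cong (step pass) (Row-irrelevant r r′)
Row-irrelevant (step leave r) (step leave r′) = cong (step leave) (Row-irrelevant r r′)
Row-irrelevant (step swap r)  (step swap r′)  = cong (step swap) (Row-irrelevant r r′)

Increasing-irrelevant : ∀ l (p q : Increasing l) → p ≡ q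
Increasing-irrelevant []          p       q         = refl
Increasing-irrelevant (_ ∷ [])    p       q         = refl
Increasing-irrelevant (_ ∷ _ ∷ l) (p , i) (p′ , i′) =
  cong₂ _,_ (≤-irrelevant p p′) (Increasing-irrelevant (_ ∷ l) i i′)

OrientOK-irrelevant : ∀ {i j k o} (p q : OrientOK i j k o) → p ≡ q
OrientOK-irrelevant (okR p) (okR q) = cong okR (≤-irrelevant p q)
OrientOK-irrelevant (okL p) (okL q) = cong okL (≤-irrelevant p q)

Compat-irrelevant : ∀ r l (p q : Compat r l) → p ≡ q
Compat-irrelevant []      (_ ∷ [])    p q = refl
Compat-irrelevant (_ ∷ r) (_ ∷ _ ∷ l) (p , q , o , c) (p′ , q′ , o′ , c′) =
  cong₂ _,_ (≤-irrelevant p p′) (cong₂ _,_ (≤-irrelevant q q′)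
    (cong₂ _,_ (OrientOK-irrelevant o o′) (Compat-irrelevant r _ c c′)))

Chain-irrelevant : ∀ rs l (p q : Chain rs l) → p ≡ q
Chain-irrelevant []       l p q = refl
Chain-irrelevant (r ∷ rs) l (i , c , p) (i′ , c′ , p′) =
  cong₂ _,_ (Increasing-irrelevant _ i i′)
    (cong₂ _,_ (Compat-irrelevant r _ c c′) (Chain-irrelevant rs l p p′))

-- Grids and triangles.

nextRow-∷ʳ : ∀ rs r l → nextRow (rs ∷ʳ r) l ≡ nextRow rs (entries r)
nextRow-∷ʳ []       r l = refl
nextRow-∷ʳ (_ ∷ rs) r l = refl

-- A triangle lists its rows from the top and a grid from the bottom, so chains have to be extended
-- at the end.
Chain-∷ʳ⁺ : ∀ rs r l → Chain rs (entries r) → Increasing (entries r) → Compat r l → Chain (rs ∷ʳ r) l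
Chain-∷ʳ⁺ []       r l p i c = i , c , tt
Chain-∷ʳ⁺ (q ∷ rs) r l (j , d , p) i c =
  j , subst (Compat q) (sym (nextRow-∷ʳ rs r l)) d , Chain-∷ʳ⁺ rs r l p i c

Chain-∷ʳ⁻ : ∀ rs r l → Chain (rs ∷ʳ r) l → Chain rs (entries r) × Increasing (entries r) × Compat r l
Chain-∷ʳ⁻ []       r l (i , c , _) = tt , i , c
Chain-∷ʳ⁻ (q ∷ rs) r l (j , d , p) with p′ , i , c ← Chain-∷ʳ⁻ rs r l p =
  (j , subst (Compat q) (nextRow-∷ʳ rs r l) d , p′) , i , c

-- The topmost row of a grid is empty, so it is dropped.
gridRows : ∀ k {n} (A : Vec Bool n) → Carrier (grid 1 (ones 0 (suc k)) A) → List (List (ℕ × Orient))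
gridRows zero    A _               = []
gridRows (suc k) A (B , _ , _ , g) = gridRows k (occupied B) g ∷ʳ decode 1 B

length-∷ʳ : ∀ (rs : List (List (ℕ × Orient))) r → length (rs ∷ʳ r) ≡ suc (length rs)
length-∷ʳ rs r = trans (length-++ rs) (+-comm (length rs) 1)

gridRows-length : ∀ k {n} (A : Vec Bool n) g → length (gridRows k A g) ≡ k
gridRows-length zero    A g               = refl
gridRows-length (suc k) A (B , _ , _ , g) =
  trans (length-∷ʳ (gridRows k (occupied B) g) _) (cong suc (gridRows-length k (occupied B) g))

gridRows-chain : ∀ k {n} (A : Vec Bool n) g → Chain (gridRows k A g) (positions 1 A)
gridRows-chain zero    A g               = tt
gridRows-chain (suc k) A (B , r , _ , g) = Chain-∷ʳ⁺ (gridRows k (occupied B) g) (decode 1 B) _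
  (subst (Chain _) (sym (entries-decode 1 B)) (gridRows-chain k (occupied B) g))
  (subst Increasing (sym (entries-decode 1 B)) (positions-increasing 1 (occupied B)))
  (Row⇒Compat 0 r)

gridRows-injective : ∀ k {n} (A : Vec Bool n) g g′ → gridRows k A g ≡ gridRows k A g′ → g ≡ g′
gridRows-injective zero A (B , r , _ , p) (B′ , r′ , _ , p′) _
  -- The dropped top row is recovered from its vacancy.
  with refl ← decode-injective 1 B B′
                (trans (vacant⇒decode≡[] 1 B p) (sym (vacant⇒decode≡[] 1 B′ p′))) =
  cong₂ (λ r p → B , r , tt , p) (Row-irrelevant r r′) (Vacant-irrelevant p p′)
gridRows-injective (suc k) A (B , r , _ , g) (B′ , r′ , _ , g′) eq
  with eq₁ , eq₂ ← ∷ʳ-injective (gridRows k (occupied B) g) (gridRows k (occupied B′) g′) eq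
  with refl ← decode-injective 1 B B′ eq₂ =
  cong₂ (λ r g → B , r , tt , g) (Row-irrelevant r r′) (gridRows-injective k (occupied B) g g′ eq₁)

-- The length falls by one with each row, so a single entry is left under the vacant top row, as
-- `Compat []` requires.
gridRows-surjective : ∀ k {n} (A : Vec Bool n) rs → length (positions 1 A) ≡ suc k →
  length rs ≡ k → Chain rs (positions 1 A) →
  Σ (Carrier (grid 1 (ones 0 (suc k)) A)) λ g → gridRows k A g ≡ rs
gridRows-surjective zero {n} A [] len _ _
  with B , eq ← decode-surjective 1 n [] tt [] [] =
  (B , Compat⇒Row 0 false B A (subst (λ r → Compat r (positions 1 A)) (sym eq) (single _ len))
     , tt , decode≡[]⇒vacant 1 B eq) , refl
  where
  single : ∀ l → length l ≡ 1 → Compat [] l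
  single (_ ∷ []) _ = tt
gridRows-surjective (suc k) {n} A rs len len′ p with initLast rs
... | rs′ ∷ʳ′ r
  with p′ , i , c ← Chain-∷ʳ⁻ rs′ r _ p
  -- Interlacing keeps the entries of `r` within the range of the row below, hence within the
  -- columns.
  with B , refl ← decode-surjective 1 n r i (Compat-≥ r _ (positions-≥ 1 A) c)
                    (Compat-< r _ (positions-< 1 A) c)
  with g , refl ← gridRows-surjective k (occupied B) rs′
         (suc-injective (trans
           (cong suc (trans (cong length (sym (entries-decode 1 B))) (length-map proj₁ (decode 1 B))))
           (trans (sym (Compat-length (decode 1 B) _ c)) len)))
         (suc-injective (trans (sym (length-∷ʳ rs′ _)) len′))
         (subst (Chain rs′) (entries-decode 1 B) p′) =
  (B , Compat⇒Row 0 false B A c , tt , g) , refl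

rowsWeight : List (List (ℕ × Orient)) → List Var
rowsWeight = concatMap (List.map entryVar)

-- The two sides run through the rows in opposite orders.
gridRows-weight : ∀ k {n} (A : Vec Bool n) g →
  rowsWeight (gridRows k A g) ↭ weight (grid 1 (ones 0 (suc k)) A) g
gridRows-weight zero A (B , _ , _ , p) rewrite vacant⇒decode≡[] 1 B p = ↭-refl
gridRows-weight (suc k) A (B , _ , _ , g) = ↭-trans
  (↭-reflexive (trans (concatMap-++ _ (gridRows k (occupied B) g) _)
    (cong (rowsWeight (gridRows k (occupied B) g) ++_) (++-identityʳ _))))
  (↭-trans (++-comm _ (rowWeight 1 B)) (++⁺ˡ (rowWeight 1 B) (gridRows-weight k (occupied B) g)))

triangles : ℕ → List ℕ → WSet
triangles k l = wset (Σ (List (List (ℕ × Orient))) λ rs → (length rs ≡ k) × Chain rs l)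
  (rowsWeight ∘ proj₁)

grid≃triangles : ∀ k {n} (A : Vec Bool n) → length (positions 1 A) ≡ suc k →
  grid 1 (ones 0 (suc k)) A ≃ triangles k (positions 1 A)
grid≃triangles k A len = iso
  (λ g → gridRows k A g , gridRows-length k A g , gridRows-chain k A g)
  (λ { (rs , p , c) → proj₁ (gridRows-surjective k A rs len p c) })
  (λ { (rs , p , c) → triangle≡ (proj₂ (gridRows-surjective k A rs len p c)) })
  -- The preimage given by surjectivity has the same rows as `g`.
  (λ g → gridRows-injective k A _ g (proj₂ (gridRows-surjective k A (gridRows k A g) len _ _)))
  (gridRows-weight k A)
  where
  triangle≡ : ∀ {l rs rs′} {p : (length rs ≡ k) × Chain rs l} {q : (length rs′ ≡ k) × Chain rs′ l} →
    rs ≡ rs′ → (rs , p) ≡ (rs′ , q)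
  triangle≡ {l} {rs} refl = cong (rs ,_) (cong₂ _,_ (≡-irrelevant _ _) (Chain-irrelevant rs l _ _))

-- The bottom row and the conclusion.

positions-ones : ∀ n s (f : ℕ → ℕ) → (∀ i → s + i ≡ f i) → positions s (ones n n) ≡ applyUpTo f n
positions-ones zero    s f e = refl
positions-ones (suc n) s f e = cong₂ _∷_ (trans (sym (+-identityʳ s)) (e 0))
  (positions-ones n (suc s) (f ∘ suc) (λ i → trans (sym (+-suc s i)) (e (suc i))))

positions-bottomRow : ∀ n → positions 1 (ones n n) ≡ bottomRow n
positions-bottomRow n = trans (positions-ones n 1 suc (λ _ → refl)) (sym (map-upTo suc n))

length-bottomRow : ∀ n → length (bottomRow n) ≡ n
length-bottomRow n = trans (length-map suc (upTo n)) (length-upTo n)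

OCMT≃Tournament : ∀ n → triangles (n ∸ 1) (bottomRow n) ≃ tournaments n
-- Order `0` is separate: `0 ∸ 1` is `0`, so the empty list of rows is the only triangle, whereas
-- `grid≃triangles` assumes a bottom row with at least one entry.
OCMT≃Tournament zero = iso (λ _ → tt) (λ _ → [] , refl , tt) (λ _ → refl)
  (λ { ([] , refl , _) → refl }) (λ { ([] , _) → ↭-refl })
OCMT≃Tournament (suc k) = ≃-trans
  (≃-sym (subst (λ l → grid 1 (ones 0 (suc k)) (ones (suc k) (suc k)) ≃ triangles k l)
    (positions-bottomRow (suc k))
    (grid≃triangles k (ones (suc k) (suc k))
      (trans (cong length (positions-bottomRow (suc k))) (length-bottomRow (suc k))))))
  (grid≃tournaments (suc k))

theorem1 : (n : ℕ) →
    Σ (OCMT n ↔ Tournament n)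
    (λ f → (t : OCMT n) → tweight n (Inverse.to f t) ↭ oweight t)
theorem1 n = mk↔ₛ′ (to e) (from e) (to∘from e) (from∘to e) , weight≃ e
  where e = OCMT≃Tournament n
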